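{- There is a constant $C>0$ such that for every integer $n\ge 1$, every graph on $n$ vertices has at most $C\cdot \rho^n\cdot n$ minimal separators, where $\rho = \frac{1+\sqrt{5}}{2}$ is the golden ratio. That is, $\mathrm{sep}(n) = O(\rho^n\cdot n)$.
   Context: All graphs are finite and simple. For a graph $G=(V,E)$ and two vertices $a,b\in V$, a set $S\subseteq V\setminus\{a,b\}$ is an $(a,b)$-separator if $a$ and $b$ lie in different connected components of $G-S$ (the graph obtained by deleting the vertices of $S$). An $(a,b)$-separator is minimal if no proper subset of it is an $(a,b)$-separator. A set $S\subset V$ is a minimal separator of $G$ if it is a minimal $(a,b)$-separator for some pair of distinct vertices $a,b\in V$. $\mathrm{sep}(n)$ denotes the maximum, over all graphs on $n$ vertices, of the number of minimal separators of the graph. -}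

module Defs where

open import Data.Fin using (Fin)
open import Data.Fin.Subset using (Subset; _∉_; _⊂_)
open import Data.Integer using (+_)
open import Data.List using (List; length)
open import Data.List.Relation.Unary.All using (All)
open import Data.List.Relation.Unary.Unique.Propositional using (Unique)
open import Data.Nat using (ℕ; zero; suc)
open import Data.Product using (_×_; ∃₂)
open import Data.Rational as ℚ using (ℚ; 0ℚ; 1ℚ; ½)
open import Level using (0ℓ)
open import Relation.Binary using (Rel; Decidable; Irreflexive; Symmetric)
open import Relation.Binary.Construct.Closure.ReflexiveTransitive using (Star)
open import Relation.Binary.PropositionalEquality using (_≡_; _≢_; refl)
open import Relation.Nullary using (¬_)

-- Decidability of adjacency is the usual constructive reading of "finite graph".
record Graph (n : ℕ) : Set₁ where
  field
    Adj    : Rel (Fin n) 0ℓ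
    adj?   : Decidable Adj
    sym    : Symmetric Adj
    irrefl : Irreflexive _≡_ Adj

module _ {n : ℕ} (G : Graph n) where
  open Graph G

  AdjAvoiding : Subset n → Rel (Fin n) 0ℓ
  AdjAvoiding S x y = Adj x y × x ∉ S × y ∉ S

  -- For vertices outside S, being in the same connected component of G − S.
  ConnectedAvoiding : Subset n → Rel (Fin n) 0ℓ
  ConnectedAvoiding S = Star (AdjAvoiding S)

  IsSeparator : (a b : Fin n) → Subset n → Set
  IsSeparator a b S = a ∉ S × b ∉ S × ¬ ConnectedAvoiding S a b

  IsMinimalSeparatorFor : (a b : Fin n) → Subset n → Set
  IsMinimalSeparatorFor a b S =
    IsSeparator a b S × (∀ T → T ⊂ S → ¬ IsSeparator a b T)

  IsMinimalSeparator : Subset n → Set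
  IsMinimalSeparator S = ∃₂ λ a b → a ≢ b × IsMinimalSeparatorFor a b S

-- The real quadratic field ℚ(√5): (a +√5· b) stands for the real number a + b√5.
infix 9 _+√5·_
record ℚ[√5] : Set where
  constructor _+√5·_
  field
    rat  : ℚ
    surd : ℚ

infixl 6 _-_
infixl 7 _*_
infixr 8 _^_
infix  4 _≤_ _<_

5ℚ : ℚ
5ℚ = + 5 ℚ./ 1

fromℕ : ℕ → ℚ[√5]
fromℕ k = (+ k ℚ./ 1) +√5· 0ℚ

_-_ : ℚ[√5] → ℚ[√5] → ℚ[√5]
(a +√5· b) - (c +√5· d) = (a ℚ.- c) +√5· (b ℚ.- d)

_*_ : ℚ[√5] → ℚ[√5] → ℚ[√5]
(a +√5· b) * (c +√5· d) =
  (a ℚ.* c ℚ.+ 5ℚ ℚ.* (b ℚ.* d)) +√5· (a ℚ.* d ℚ.+ b ℚ.* c)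

_^_ : ℚ[√5] → ℕ → ℚ[√5]
x ^ zero  = fromℕ 1
x ^ suc k = x * x ^ k

-- The order inherited from ℝ.  Since t ↦ t·|t| is strictly increasing on ℝ,
-- a + b√5 = b√5 − (−a) has the same sign as 5·b·|b| − (−a)·|−a| = a·|a| + 5·b·|b|.
signed : ℚ[√5] → ℚ
signed (a +√5· b) = a ℚ.* ℚ.∣ a ∣ ℚ.+ 5ℚ ℚ.* (b ℚ.* ℚ.∣ b ∣)

_≤_ : Rel ℚ[√5] 0ℓ
x ≤ y = 0ℚ ℚ.≤ signed (y - x)

_<_ : Rel ℚ[√5] 0ℓ
x < y = 0ℚ ℚ.< signed (y - x)

√5 : ℚ[√5]
√5 = 0ℚ +√5· 1ℚ

√5*√5≡5 : √5 * √5 ≡ fromℕ 5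
√5*√5≡5 = refl

-- (1 + √5) / 2
ρ : ℚ[√5]
ρ = ½ +√5· ½

-- The number of elements satisfying P is at most x.  Quantifying over repetition-free
-- lists avoids having to decide P in order to speak of its cardinality.
NumberAtMost : {A : Set} → (A → Set) → ℚ[√5] → Set
NumberAtMost {A} P x =
  (xs : List A) → Unique xs → All P xs → fromℕ (length xs) ≤ x

{-# OPTIONS --safe #-}

-- A minimal (a,b)-separator S is the neighbourhood of the component of a and of the
-- component of b in G − S.  The smaller of these, K, satisfies 2|K| + |S| ≤ n.  To list
-- the neighbourhoods S of connected sets K ∋ v with 2|K| + |S| ≤ n, grow C ⊆ K from {v}
-- and F ⊆ S from ∅: branching on a neighbour u of C outside C ∪ F, either u joins C, which
-- costs 2 of the budget n − 2|C| − |F|, or u joins F, which costs 1; when no such u exists,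
-- S = F.  Hence each of the n choices of v yields at most a Fibonacci number of sets.
module Submission where

open import Data.Nat as ℕ using (ℕ; zero; suc; z≤n; s≤s)
open import Data.Product using (∃; _×_; _,_; proj₂)
open import Defs

open import Data.Bool.Properties using () renaming (_≟_ to _≟ᵇ_)
open import Data.Empty using (⊥-elim)
open import Data.Fin as Fin using (Fin)
import Data.Fin.Properties as Fin
open import Data.Fin.Subset
  using (Subset; inside; outside; _∈_; _∉_; _⊆_; _∪_; ⁅_⁆; ∣_∣)
  renaming (⊥ to ∅; _-_ to _∖_)
import Data.Fin.Subset.Properties as Subset
open import Data.Integer as ℤ using (+_)
import Data.Integer.Properties as ℤ
open import Data.List as List using (List; []; _∷_; _++_; length)
open import Data.List.Membership.Propositional using () renaming (_∈_ to _∈ˡ_)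
open import Data.List.Membership.Propositional.Properties using (∈-++⁺ˡ; ∈-++⁺ʳ; ∈-lookup)
import Data.List.Membership.DecPropositional as DecMembership
open import Data.List.Properties using (length-++)
open import Data.List.Relation.Unary.All as All using (All)
open import Data.List.Relation.Unary.AllPairs using (_∷_)
open import Data.List.Relation.Unary.Any using (here; index)
open import Data.List.Relation.Unary.Any.Properties using (lookup-index)
open import Data.List.Relation.Unary.Unique.Propositional using (Unique)
import Data.Nat.Coprimality as Coprimality
import Data.Nat.Properties as ℕ
open import Data.Nat.Solver using () renaming (module +-*-Solver to ℕ-Solver)
open import Data.Rational as ℚ using (ℚ; mkℚ; 0ℚ; 1ℚ; ½)
import Data.Rational.Properties as ℚ
open import Data.Rational.Solver using () renaming (module +-*-Solver to ℚ-Solver)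
open import Data.Sum using (inj₁; inj₂)
open import Data.Vec as Vec using ([]; _∷_)
import Data.Vec.Properties as Vec
open import Effect.Monad using (RawMonad)
open import Function using (_∘_; Injective)
open import Relation.Binary.Construct.Closure.ReflexiveTransitive
  using (ε; _◅_; _◅◅_; reverse)
open import Relation.Binary.PropositionalEquality
open import Relation.Nullary using (¬_; Dec; yes; no; does; contradiction; ¬¬-excluded-middle)
open import Relation.Nullary.Decidable
  using (_×-dec_; ¬?; decidable-stable; dec-true)
open import Relation.Nullary.Negation using (¬¬-Monad)

private
  variable
    n : ℕ
    A : Set

-- Counting by covering lists

-- The list may repeat entries and hold elements outside `P`, so an upper bound on the number of
-- elements of `P` can be given without deciding `P`.
CoveredBy : ℕ → (A → Set) → Set
CoveredBy k P = ∃ λ ys → length ys ℕ.≤ k × (∀ {x} → P x → x ∈ˡ ys)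

CoveredBy-∃ : ∀ {k n} {P : Fin n → A → Set} → (∀ i → CoveredBy k (P i)) →
              CoveredBy (n ℕ.* k) (λ x → ∃ λ i → P i x)
CoveredBy-∃ {n = zero} c = [] , z≤n , λ ()
CoveredBy-∃ {n = suc n} c with c Fin.zero | CoveredBy-∃ (c ∘ Fin.suc)
... | ys , ∣ys∣≤ , ∈ys | zs , ∣zs∣≤ , ∈zs =
  ys ++ zs ,
  subst (ℕ._≤ _) (sym (length-++ ys)) (ℕ.+-mono-≤ ∣ys∣≤ ∣zs∣≤) ,
  λ { (Fin.zero , p) → ∈-++⁺ˡ (∈ys p) ; (Fin.suc i , p) → ∈-++⁺ʳ ys (∈zs (i , p)) }

lookup-injective : ∀ {xs : List A} → Unique xs → Injective _≡_ _≡_ (List.lookup xs)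
lookup-injective (_ ∷ _) {Fin.zero} {Fin.zero} _ = refl
lookup-injective (x∉ ∷ _) {Fin.zero} {Fin.suc j} eq = contradiction eq (All.lookup x∉ (∈-lookup j))
lookup-injective (x∉ ∷ _) {Fin.suc i} {Fin.zero} eq =
  contradiction (sym eq) (All.lookup x∉ (∈-lookup i))
lookup-injective (_ ∷ u) {Fin.suc i} {Fin.suc j} eq = cong Fin.suc (lookup-injective u eq)

-- Pigeonhole: sending a position in `xs` to the position of its entry in `ys` is injective, since
-- equal images mean equal entries and `xs` has no repetitions.
Unique⇒length≤ : ∀ {xs ys : List A} → Unique xs → (∀ {x} → x ∈ˡ xs → x ∈ˡ ys) →
                 length xs ℕ.≤ length ys
Unique⇒length≤ {xs = xs} {ys} u xs⊆ys = Fin.injective⇒≤ {f = λ i → index (pos i)} λ {i} {j} eq →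
  lookup-injective u
    (trans (lookup-index (pos i)) (trans (cong (List.lookup ys) eq) (sym (lookup-index (pos j)))))
  where
  pos : ∀ i → List.lookup xs i ∈ˡ ys
  pos i = xs⊆ys (∈-lookup i)

-- Subsets of Fin n

subset : {P : Fin n → Set} → (∀ x → Dec (P x)) → Subset n
subset P? = Vec.tabulate (does ∘ P?)

∈-subset⁺ : ∀ {P : Fin n → Set} (P? : ∀ x → Dec (P x)) {x} → P x → x ∈ subset P?
∈-subset⁺ P? {x} p =
  Vec.lookup⇒[]= x _ (trans (Vec.lookup∘tabulate (does ∘ P?) x) (dec-true (P? x) p))

∈-subset⁻ : ∀ {P : Fin n → Set} (P? : ∀ x → Dec (P x)) {x} → x ∈ subset P? → P x
∈-subset⁻ P? {x} x∈ with P? x | trans (sym (Vec.lookup∘tabulate (does ∘ P?) x)) (Vec.[]=⇒lookup x∈)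
... | yes p | _ = p
... | no _  | ()

Disjoint : Subset n → Subset n → Set
Disjoint p q = ∀ {x} → x ∈ p → x ∉ q

drop-∷-Disjoint : ∀ {s t} {p q : Subset n} → Disjoint (s ∷ p) (t ∷ q) → Disjoint p q
drop-∷-Disjoint dis x∈p x∈q = dis (Vec.there x∈p) (Vec.there x∈q)

∣p∣+∣q∣≤∣p∪q∣ : (p q : Subset n) → Disjoint p q → ∣ p ∣ ℕ.+ ∣ q ∣ ℕ.≤ ∣ p ∪ q ∣
∣p∣+∣q∣≤∣p∪q∣ [] [] _ = z≤n
∣p∣+∣q∣≤∣p∪q∣ (inside  ∷ p) (inside  ∷ q) dis = contradiction Vec.here (dis Vec.here)
∣p∣+∣q∣≤∣p∪q∣ (inside  ∷ p) (outside ∷ q) dis = s≤s (∣p∣+∣q∣≤∣p∪q∣ p q (drop-∷-Disjoint dis))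
∣p∣+∣q∣≤∣p∪q∣ (outside ∷ p) (inside  ∷ q) dis =
  ℕ.≤-trans (ℕ.≤-reflexive (ℕ.+-suc ∣ p ∣ ∣ q ∣)) (s≤s (∣p∣+∣q∣≤∣p∪q∣ p q (drop-∷-Disjoint dis)))
∣p∣+∣q∣≤∣p∪q∣ (outside ∷ p) (outside ∷ q) dis = ∣p∣+∣q∣≤∣p∪q∣ p q (drop-∷-Disjoint dis)

∪-⊆ : {p q r : Subset n} → p ⊆ r → q ⊆ r → p ∪ q ⊆ r
∪-⊆ {p = p} {q} p⊆r q⊆r x∈ with Subset.x∈p∪q⁻ p q x∈
... | inj₁ x∈p = p⊆r x∈p
... | inj₂ x∈q = q⊆r x∈q

⁅⁆-⊆ : {u : Fin n} {p : Subset n} → u ∈ p → ⁅ u ⁆ ⊆ p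
⁅⁆-⊆ {u = u} u∈p x∈ = subst (_∈ _) (sym (Subset.x∈⁅y⁆⇒x≡y u x∈)) u∈p

∣p∣<∣p∪⁅u⁆∣ : (p : Subset n) {u : Fin n} → u ∉ p → ∣ p ∣ ℕ.< ∣ p ∪ ⁅ u ⁆ ∣
∣p∣<∣p∪⁅u⁆∣ p {u} u∉p = Subset.p⊂q⇒∣p∣<∣q∣
  (Subset.p⊆p∪q ⁅ u ⁆ , u , Subset.q⊆p∪q p ⁅ u ⁆ (Subset.x∈⁅x⁆ u) , u∉p)

-- Full components and the branching

cost : Subset n → Subset n → ℕ
cost C F = ∣ C ∣ ℕ.+ ∣ C ∣ ℕ.+ ∣ F ∣

cost-mono : {C D F S : Subset n} → C ⊆ D → F ⊆ S → cost C F ℕ.≤ cost D S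
cost-mono C⊆D F⊆S = ℕ.+-mono-≤ (ℕ.+-mono-≤ C≤D C≤D) (Subset.p⊆q⇒∣p∣≤∣q∣ F⊆S)
  where C≤D = Subset.p⊆q⇒∣p∣≤∣q∣ C⊆D

-- `C` counts twice in the cost, so its growth moves two units from the remaining budget into the
-- cost. Addition on both sides avoids truncated subtraction.
cost-∪ˡ : (C F : Subset n) {u : Fin n} (μ : ℕ) → u ∉ C →
          cost C F ℕ.+ suc (suc μ) ℕ.≤ cost (C ∪ ⁅ u ⁆) F ℕ.+ μ
cost-∪ˡ C F μ u∉C = ℕ.≤-trans (ℕ.≤-reflexive
  (solve 3 (λ c f m → c :+ c :+ f :+ (con 2 :+ m) := (con 1 :+ c) :+ (con 1 :+ c) :+ f :+ m)
    refl ∣ C ∣ ∣ F ∣ μ))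
  (ℕ.+-monoˡ-≤ μ (ℕ.+-monoˡ-≤ ∣ F ∣ (ℕ.+-mono-≤ c< c<)))
  where
  open ℕ-Solver
  c< = ∣p∣<∣p∪⁅u⁆∣ C u∉C

cost-∪ʳ : (C F : Subset n) {u : Fin n} (μ : ℕ) → u ∉ F →
          cost C F ℕ.+ suc μ ℕ.≤ cost C (F ∪ ⁅ u ⁆) ℕ.+ μ
cost-∪ʳ C F μ u∉F = ℕ.≤-trans (ℕ.≤-reflexive
  (solve 3 (λ c f m → c :+ c :+ f :+ (con 1 :+ m) := c :+ c :+ (con 1 :+ f) :+ m)
    refl ∣ C ∣ ∣ F ∣ μ))
  (ℕ.+-monoˡ-≤ μ (ℕ.+-monoʳ-≤ (∣ C ∣ ℕ.+ ∣ C ∣) (∣p∣<∣p∪⁅u⁆∣ F u∉F)))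
  where open ℕ-Solver

-- The value 0 at 0 matches an exhausted budget. The summands follow the two branches: joining `C`
-- leaves `k`, joining `F` leaves `suc k`.
fib : ℕ → ℕ
fib 0             = 0
fib 1             = 1
fib (suc (suc k)) = fib k ℕ.+ fib (suc k)

1≤fib : ∀ k → 1 ℕ.≤ fib (suc k)
1≤fib zero    = s≤s z≤n
1≤fib (suc k) = ℕ.≤-trans (1≤fib k) (ℕ.m≤n+m _ (fib k))

-- Connectivity in `G` minus `S` is never decided outright. Double negation commutes with finite
-- products, so it may be assumed decided at all vertices at once when proving a negation.
¬¬-Π-Dec : (P : Fin n → Set) → ¬ ¬ (∀ x → Dec (P x))
¬¬-Π-Dec P = Fin.sequence (RawMonad.rawApplicative ¬¬-Monad) (λ _ → ¬¬-excluded-middle)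

module _ {n : ℕ} (G : Graph n) where
  open Graph G renaming (sym to Adj-sym)

  -- `K` is the component of `v` in `G` minus `S`, and it is full: its neighbourhood is all of `S`,
  -- so `K` determines `S`.
  record FullComponent (v : Fin n) (S K : Subset n) : Set where
    field
      root      : v ∈ K
      connected : ∀ {x} → x ∈ K → ConnectedAvoiding G S v x
      disjoint  : Disjoint K S
      closed    : ∀ {x y} → x ∈ K → Adj x y → y ∉ S → y ∈ K
      full      : ∀ {s} → s ∈ S → ∃ λ x → x ∈ K × Adj x s

  Frontier : Subset n → Subset n → Fin n → Set
  Frontier C F u = u ∉ C × u ∉ F × ∃ λ x → x ∈ C × Adj x u

  frontier? : ∀ C F → Dec (∃ (Frontier C F))
  frontier? C F = Fin.any? λ u → ¬? (u Subset.∈? C) ×-dec ¬? (u Subset.∈? F)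
    ×-dec Fin.any? λ x → (x Subset.∈? C) ×-dec adj? x u

  -- A walk from `v` avoiding `S` also avoids `F`, so with no frontier it cannot leave `C`; thus `C`
  -- contains `K`. Each vertex of `S` has a neighbour in `K`, hence in `C`, and can then only lie in
  -- `F`.
  no-frontier⇒≡ : ∀ {v S K C F} → FullComponent v S K → v ∈ C → C ⊆ K → F ⊆ S →
                  ¬ ∃ (Frontier C F) → S ≡ F
  no-frontier⇒≡ {v} {S} {K} {C} {F} fc v∈C C⊆K F⊆S none = Subset.⊆-antisym S⊆F F⊆S
    where
    open FullComponent fc

    reached : ∀ {x y} → x ∈ C → ConnectedAvoiding G S x y → y ∈ C
    reached x∈C ε = x∈C
    reached x∈C (_◅_ {j = z} (x~z , _ , z∉S) p) = reached z∈C p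
      where
      z∈C : z ∈ C
      z∈C = decidable-stable (z Subset.∈? C)
        λ z∉C → none (z , z∉C , z∉S ∘ F⊆S , _ , x∈C , x~z)

    S⊆F : S ⊆ F
    S⊆F {s} s∈S with full s∈S
    ... | x , x∈K , x~s = decidable-stable (s Subset.∈? F) λ s∉F →
      none (s , (λ s∈C → disjoint (C⊆K s∈C) s∈S) , s∉F , x , reached v∈C (connected x∈K) , x~s)

  -- The strict inequality makes `μ` exceed by one the cost that may still be added, so that no `S`
  -- is left at `μ` = 0.
  record Extends (v : Fin n) (C F : Subset n) (μ : ℕ) (S : Subset n) : Set where
    constructor extends
    field
      {K}       : Subset n
      component : FullComponent v S K
      C⊆K       : C ⊆ K
      F⊆S       : F ⊆ S
      budget    : cost K S ℕ.< cost C F ℕ.+ μ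

  ¬Extends-0 : ∀ {v C F S} → ¬ Extends v C F 0 S
  ¬Extends-0 {C = C} {F} (extends _ C⊆K F⊆S b) =
    ℕ.<⇒≱ (ℕ.<-≤-trans b (ℕ.≤-reflexive (ℕ.+-identityʳ (cost C F)))) (cost-mono C⊆K F⊆S)

  Extends-S : ∀ {v C F μ S u} → Extends v C F (suc μ) S → Frontier C F u → u ∈ S →
              Extends v C (F ∪ ⁅ u ⁆) μ S
  Extends-S {C = C} {F} {μ} (extends fc C⊆K F⊆S b) (_ , u∉F , _) u∈S =
    extends fc C⊆K (∪-⊆ F⊆S (⁅⁆-⊆ u∈S)) (ℕ.≤-trans b (cost-∪ʳ C F μ u∉F))

  Extends-K : ∀ {v C F μ S u} → Extends v C F (suc (suc μ)) S → Frontier C F u → u ∉ S →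
              Extends v (C ∪ ⁅ u ⁆) F μ S
  Extends-K {C = C} {F} {μ} (extends fc C⊆K F⊆S b) (u∉C , _ , x , x∈C , x~u) u∉S =
    extends fc (∪-⊆ C⊆K (⁅⁆-⊆ (FullComponent.closed fc (C⊆K x∈C) x~u u∉S))) F⊆S
      (ℕ.≤-trans b (cost-∪ˡ C F μ u∉C))

  Extends-weaken : ∀ {v C F μ S} → Extends v C F μ S → Extends v C F (suc μ) S
  Extends-weaken {C = C} {F} {μ} (extends fc C⊆K F⊆S b) =
    extends fc C⊆K F⊆S (ℕ.≤-trans b (ℕ.+-monoʳ-≤ (cost C F) (ℕ.n≤1+n μ)))

  branching : ∀ μ {v C F} → v ∈ C → CoveredBy (fib μ) (Extends v C F μ)
  branching zero _ = [] , z≤n , λ e → ⊥-elim (¬Extends-0 e)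
  branching (suc μ) {v} {C} {F} v∈C with frontier? C F
  ... | no none = F ∷ [] , 1≤fib μ ,
    λ (extends fc C⊆K F⊆S _) → here (no-frontier⇒≡ fc v∈C C⊆K F⊆S none)
  branching (suc zero) v∈C | yes (u , fr) = [] , z≤n , λ {S} e → ⊥-elim (impossible S e)
    where
    impossible : ∀ S → ¬ Extends _ _ _ 1 S
    impossible S e with u Subset.∈? S
    ... | yes u∈S = ¬Extends-0 (Extends-S e fr u∈S)
    -- Joining `C` costs 2, so the budget 1 is first relaxed to 2; even then nothing remains.
    ... | no u∉S  = ¬Extends-0 (Extends-K (Extends-weaken e) fr u∉S)
  branching (suc (suc μ)) {v} {C} {F} v∈C | yes (u , fr)
    with branching μ {v} {C ∪ ⁅ u ⁆} {F} (Subset.p⊆p∪q ⁅ u ⁆ v∈C)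
       | branching (suc μ) {v} {C} {F ∪ ⁅ u ⁆} v∈C
  ... | ys , ∣ys∣≤ , ∈ys | zs , ∣zs∣≤ , ∈zs =
    ys ++ zs ,
    subst (ℕ._≤ _) (sym (length-++ ys)) (ℕ.+-mono-≤ ∣ys∣≤ ∣zs∣≤) ,
    ∈ys++zs
    where
    ∈ys++zs : ∀ {S} → Extends v C F (suc (suc μ)) S → S ∈ˡ ys ++ zs
    ∈ys++zs {S} e with u Subset.∈? S
    ... | yes u∈S = ∈-++⁺ʳ ys (∈zs (Extends-S e fr u∈S))
    ... | no u∉S  = ∈-++⁺ˡ (∈ys (Extends-K e fr u∉S))

  -- From minimal separators to full components

  connected-∉ : ∀ {S a x} → a ∉ S → ConnectedAvoiding G S a x → x ∉ S
  connected-∉ a∉S ε = a∉S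
  connected-∉ a∉S ((_ , _ , y∉S) ◅ p) = connected-∉ y∉S p

  connected-sym : ∀ {S x y} → ConnectedAvoiding G S x y → ConnectedAvoiding G S y x
  connected-sym = reverse λ (x~y , x∉S , y∉S) → Adj-sym x~y , y∉S , x∉S

  minimal-sym : ∀ {a b S} → IsMinimalSeparatorFor G a b S → IsMinimalSeparatorFor G b a S
  minimal-sym ((a∉S , b∉S , sep) , min) =
    (b∉S , a∉S , sep ∘ connected-sym) ,
    λ T T⊂S (b∉T , a∉T , sepT) → min T T⊂S (a∉T , b∉T , sepT ∘ connected-sym)

  -- If `s` had no neighbour in the component of `a`, a walk from `a` avoiding the rest of `S` could
  -- never enter `s`. It would avoid `S` altogether, so `S` without `s` would still separate,
  -- against minimality.
  minimal⇒¬¬neighbour : ∀ {a b S s} → IsMinimalSeparatorFor G a b S → s ∈ S →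
                        ¬ ¬ ∃ λ x → ConnectedAvoiding G S a x × Adj x s
  minimal⇒¬¬neighbour {a} {b} {S} {s} ((a∉S , b∉S , sep) , min) s∈S none =
    min (S ∖ s) (Subset.x∈p⇒p-x⊂p s∈S) (a∉S ∘ S∖s⊆S , b∉S ∘ S∖s⊆S , sep ∘ avoid ε)
    where
    S∖s⊆S : S ∖ s ⊆ S
    S∖s⊆S = Subset.p─q⊆p S ⁅ s ⁆

    -- The first argument accumulates the part of the walk already known to avoid `S`; it places `x`
    -- in the component of `a`.
    avoid : ∀ {x} → ConnectedAvoiding G S a x → ConnectedAvoiding G (S ∖ s) x b →
            ConnectedAvoiding G S a b
    avoid a⋯x ε = a⋯x
    avoid {x} a⋯x (_◅_ {j = y} (x~y , _ , y∉S∖s) p) =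
      avoid (a⋯x ◅◅ (x~y , connected-∉ a∉S a⋯x , y∉S) ◅ ε) p
      where
      y∉S : y ∉ S
      y∉S y∈S = y∉S∖s (Subset.x∈p∧x≢y⇒x∈p-y y∈S λ { refl → none (x , a⋯x , x~y) })

  component-full : ∀ {a b S} → IsMinimalSeparatorFor G a b S →
                   (conn? : ∀ x → Dec (ConnectedAvoiding G S a x)) →
                   FullComponent a S (subset conn?)
  component-full {a} {b} {S} m@((a∉S , _) , _) conn? = record
    { root      = ∈-subset⁺ conn? ε
    ; connected = ∈-subset⁻ conn?
    ; disjoint  = disj
    ; closed    = λ x∈K x~y y∉S →
        ∈-subset⁺ conn? (∈-subset⁻ conn? x∈K ◅◅ (x~y , disj x∈K , y∉S) ◅ ε)
    -- Membership in the subset and adjacency are decidable, so a finite search removes the double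
    -- negation.
    ; full      = λ {s} s∈S →
        decidable-stable (Fin.any? λ x → (x Subset.∈? subset conn?) ×-dec adj? x s)
          λ none → minimal⇒¬¬neighbour m s∈S
            λ (x , a⋯x , x~s) → none (x , ∈-subset⁺ conn? a⋯x , x~s)
    }
    where
    disj : Disjoint (subset conn?) S
    disj = connected-∉ a∉S ∘ ∈-subset⁻ conn?

  SmallFullComponent : Fin n → Subset n → Set
  SmallFullComponent v S = ∃ λ K → FullComponent v S K × cost K S ℕ.≤ n

  -- The components of `a` and `b` and the set `S` are pairwise disjoint, so their sizes sum to at
  -- most `n`; replacing the larger component by the smaller keeps this bound.
  minimal⇒¬¬small : ∀ {a b S} → IsMinimalSeparatorFor G a b S →
                    ¬ ¬ ∃ λ v → SmallFullComponent v S
  minimal⇒¬¬small {a} {b} {S} m@((_ , _ , sep) , _) no-small =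
    ¬¬-Π-Dec (ConnectedAvoiding G S a) λ conn?ᵃ →
    ¬¬-Π-Dec (ConnectedAvoiding G S b) λ conn?ᵇ →
    no-small (smaller conn?ᵃ conn?ᵇ)
    where
    module _ (conn?ᵃ : ∀ x → Dec (ConnectedAvoiding G S a x))
             (conn?ᵇ : ∀ x → Dec (ConnectedAvoiding G S b x)) where
      Kᵃ Kᵇ : Subset n
      Kᵃ = subset conn?ᵃ
      Kᵇ = subset conn?ᵇ

      fullᵃ : FullComponent a S Kᵃ
      fullᵃ = component-full m conn?ᵃ

      fullᵇ : FullComponent b S Kᵇ
      fullᵇ = component-full (minimal-sym m) conn?ᵇ

      Kᵃ∥Kᵇ : Disjoint Kᵃ Kᵇ
      Kᵃ∥Kᵇ x∈Kᵃ x∈Kᵇ = sep (∈-subset⁻ conn?ᵃ x∈Kᵃ ◅◅ connected-sym (∈-subset⁻ conn?ᵇ x∈Kᵇ))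

      Kᵃ∪Kᵇ∥S : Disjoint (Kᵃ ∪ Kᵇ) S
      Kᵃ∪Kᵇ∥S x∈K with Subset.x∈p∪q⁻ Kᵃ Kᵇ x∈K
      ... | inj₁ x∈Kᵃ = FullComponent.disjoint fullᵃ x∈Kᵃ
      ... | inj₂ x∈Kᵇ = FullComponent.disjoint fullᵇ x∈Kᵇ

      sum≤n : ∣ Kᵃ ∣ ℕ.+ ∣ Kᵇ ∣ ℕ.+ ∣ S ∣ ℕ.≤ n
      sum≤n = begin
        ∣ Kᵃ ∣ ℕ.+ ∣ Kᵇ ∣ ℕ.+ ∣ S ∣ ≤⟨ ℕ.+-monoˡ-≤ ∣ S ∣ (∣p∣+∣q∣≤∣p∪q∣ Kᵃ Kᵇ Kᵃ∥Kᵇ) ⟩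
        ∣ Kᵃ ∪ Kᵇ ∣ ℕ.+ ∣ S ∣       ≤⟨ ∣p∣+∣q∣≤∣p∪q∣ (Kᵃ ∪ Kᵇ) S Kᵃ∪Kᵇ∥S ⟩
        ∣ (Kᵃ ∪ Kᵇ) ∪ S ∣           ≤⟨ Subset.∣p∣≤n ((Kᵃ ∪ Kᵇ) ∪ S) ⟩
        n                           ∎
        where open ℕ.≤-Reasoning

      smaller : ∃ λ v → SmallFullComponent v S
      smaller with ℕ.≤-total ∣ Kᵃ ∣ ∣ Kᵇ ∣
      ... | inj₁ a≤b = a , Kᵃ , fullᵃ ,
        ℕ.≤-trans (ℕ.+-monoˡ-≤ ∣ S ∣ (ℕ.+-monoʳ-≤ ∣ Kᵃ ∣ a≤b)) sum≤n
      ... | inj₂ b≤a = b , Kᵇ , fullᵇ ,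
        ℕ.≤-trans (ℕ.+-monoˡ-≤ ∣ S ∣ (ℕ.+-monoˡ-≤ ∣ Kᵇ ∣ b≤a)) sum≤n

minimal-separators-≤ : ∀ {m} (G : Graph (suc m)) (xs : List (Subset (suc m))) → Unique xs →
                       All (IsMinimalSeparator G) xs → length xs ℕ.≤ suc m ℕ.* fib m
minimal-separators-≤ {m} G xs unique minimal with CoveredBy-∃ (λ v → branching G m (Subset.x∈⁅x⁆ v))
... | ys , ∣ys∣≤ , ∈ys = ℕ.≤-trans (Unique⇒length≤ unique λ {S} S∈xs →
    -- Membership in the explicit list `ys` is decidable, which discharges the double negation left
    -- by the undecided components.
    decidable-stable (S ∈? ys) λ S∉ys →
      minimal⇒¬¬small G (proj₂ (proj₂ (proj₂ (All.lookup minimal S∈xs))))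
        λ small → S∉ys (∈ys (initial small))) ∣ys∣≤
  where
  open DecMembership (Vec.≡-dec {n = suc m} _≟ᵇ_) using (_∈?_)

  initial : ∀ {S} → (∃ λ v → SmallFullComponent G v S) → ∃ λ v → Extends G v ⁅ v ⁆ ∅ m S
  initial {S} (v , K , fc , K+S≤n) =
    v , extends fc (⁅⁆-⊆ (FullComponent.root fc)) (λ x∈∅ → contradiction x∈∅ Subset.∉⊥) budget
    where
    budget : cost K S ℕ.< cost ⁅ v ⁆ ∅ ℕ.+ m
    -- The start `{v}` already costs 2, so a total of at most `suc m` is strictly below `2 + m`: the
    -- budget is `m`, not `suc m`.
    budget rewrite Subset.∣⁅x⁆∣≡1 v | Subset.∣⊥∣≡0 (suc m) = s≤s K+S≤n

-- The golden ratio

ι : ℕ → ℚ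
ι k = + k ℚ./ 1

-- Division normalises through a gcd, which is stuck for variable `k`; the explicit fraction lets
-- sums, products and comparisons reduce to integers.
ι-mkℚ : ∀ k → ι k ≡ mkℚ (+ k) 0 (Coprimality.sym (Coprimality.1-coprimeTo k))
ι-mkℚ k = ℚ.normalize-coprime (Coprimality.sym (Coprimality.1-coprimeTo k))

ι-+ : ∀ j k → ι (j ℕ.+ k) ≡ ι j ℚ.+ ι k
ι-+ j k rewrite ι-mkℚ j | ι-mkℚ k =
  cong (ℚ._/ 1) (sym (cong₂ ℤ._+_ (ℤ.*-identityʳ (+ j)) (ℤ.*-identityʳ (+ k))))

ι-* : ∀ j k → ι (j ℕ.* k) ≡ ι j ℚ.* ι k
ι-* j k rewrite ι-mkℚ j | ι-mkℚ k = cong (ℚ._/ 1) (ℤ.pos-* j k)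

ι-mono : ∀ {j k} → j ℕ.≤ k → ι j ℚ.≤ ι k
ι-mono {j} {k} j≤k rewrite ι-mkℚ j | ι-mkℚ k =
  ℚ.*≤* (ℤ.*-monoʳ-≤-nonNeg (+ 1) (ℤ.+≤+ j≤k))

0≤ι : ∀ k → 0ℚ ℚ.≤ ι k
0≤ι k = ι-mono {0} {k} z≤n

0≤+ : ∀ {p q} → 0ℚ ℚ.≤ p → 0ℚ ℚ.≤ q → 0ℚ ℚ.≤ p ℚ.+ q
0≤+ = ℚ.+-mono-≤

0≤* : ∀ {p q} → 0ℚ ℚ.≤ p → 0ℚ ℚ.≤ q → 0ℚ ℚ.≤ p ℚ.* q
0≤* {p} {q} 0≤p 0≤q = ℚ.nonNegative⁻¹ (p ℚ.* q)
  {{ℚ.nonNeg*nonNeg⇒nonNeg p {{ℚ.nonNegative 0≤p}} q {{ℚ.nonNegative 0≤q}}}}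

p≤q⇒0≤q-p : ∀ {p q} → p ℚ.≤ q → 0ℚ ℚ.≤ q ℚ.- p
p≤q⇒0≤q-p {p} {q} p≤q =
  subst (ℚ._≤ q ℚ.- p) (ℚ.+-inverseʳ p) (ℚ.+-monoˡ-≤ (ℚ.- p) p≤q)

0≤5 : 0ℚ ℚ.≤ 5ℚ
0≤5 = 0≤ι 5

0≤½ : 0ℚ ℚ.≤ ½
0≤½ = ℚ.nonNegative⁻¹ ½

-- Both coordinates of the difference are nonnegative, hence so is each summand of `signed`.
fromℕ≤ : ∀ {l p q} → ι l ℚ.≤ p → 0ℚ ℚ.≤ q → fromℕ l ≤ (p +√5· q)
fromℕ≤ {l} {p} {q} l≤p 0≤q = 0≤+ (0≤* 0≤a (ℚ.0≤∣p∣ a)) (0≤* 0≤5 (0≤* 0≤b (ℚ.0≤∣p∣ b)))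
  where
  a b : ℚ
  a = p ℚ.- ι l
  b = q ℚ.- 0ℚ

  0≤a : 0ℚ ℚ.≤ a
  0≤a = p≤q⇒0≤q-p l≤p

  0≤b : 0ℚ ℚ.≤ b
  0≤b = 0≤+ 0≤q ℚ.≤-refl

-- In these coordinates multiplication by `ρ` is the Fibonacci step from (x, y) to (y, x + y).
ρ* : ∀ x y → ρ * ((x ℚ.+ ½ ℚ.* y) +√5· (½ ℚ.* y)) ≡
             (y ℚ.+ ½ ℚ.* (x ℚ.+ y)) +√5· (½ ℚ.* (x ℚ.+ y))
ρ* x y = cong₂ _+√5·_
  (solve 2 (λ x y → con ½ :* (x :+ con ½ :* y) :+ con 5ℚ :* (con ½ :* (con ½ :* y))
                 := y :+ con ½ :* (x :+ y)) refl x y)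
  (solve 2 (λ x y → con ½ :* (con ½ :* y) :+ con ½ :* (x :+ con ½ :* y)
                 := con ½ :* (x :+ y)) refl x y)
  where open ℚ-Solver

scale : ∀ r s k → fromℕ 1 * (r +√5· s) * (k +√5· 0ℚ) ≡ (r ℚ.* k) +√5· (s ℚ.* k)
scale r s k = cong₂ _+√5·_
  (solve 3 (λ r s k → (con 1ℚ :* r :+ con 5ℚ :* (con 0ℚ :* s)) :* k
                        :+ con 5ℚ :* ((con 1ℚ :* s :+ con 0ℚ :* r) :* con 0ℚ)
                   := r :* k) refl r s k)
  (solve 3 (λ r s k → (con 1ℚ :* r :+ con 5ℚ :* (con 0ℚ :* s)) :* con 0ℚ
                        :+ (con 1ℚ :* s :+ con 0ℚ :* r) :* k
                   := s :* k) refl r s k)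
  where open ℚ-Solver

-- ρⁿ = (Lₙ + Fₙ√5)/2 with the Lucas number written as Lₙ = 2Fₙ₋₁ + Fₙ.
ρ^ : ∀ m → ρ ^ suc m ≡ (ι (fib m) ℚ.+ ½ ℚ.* ι (fib (suc m))) +√5· (½ ℚ.* ι (fib (suc m)))
ρ^ zero    = refl
ρ^ (suc m) = trans (cong (ρ *_) (ρ^ m))
  (trans (ρ* (ι (fib m)) (ι (fib (suc m))))
    (cong (λ z → (ι (fib (suc m)) ℚ.+ ½ ℚ.* z) +√5· (½ ℚ.* z)) (sym (ι-+ (fib m) (fib (suc m))))))

n*fib≤ρ^n*n : ∀ m {l} → l ℕ.≤ suc m ℕ.* fib m →
              fromℕ l ≤ fromℕ 1 * ρ ^ suc m * fromℕ (suc m)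
n*fib≤ρ^n*n m {l} l≤ = subst (fromℕ l ≤_) (sym expand) (fromℕ≤ {l} l≤rat (0≤* 0≤½y 0≤k))
  where
  x y k : ℚ
  x = ι (fib m)
  y = ι (fib (suc m))
  k = ι (suc m)

  expand : fromℕ 1 * ρ ^ suc m * fromℕ (suc m) ≡ ((x ℚ.+ ½ ℚ.* y) ℚ.* k) +√5· (½ ℚ.* y ℚ.* k)
  expand = trans (cong (λ z → fromℕ 1 * z * fromℕ (suc m)) (ρ^ m))
                 (scale (x ℚ.+ ½ ℚ.* y) (½ ℚ.* y) k)

  0≤k : 0ℚ ℚ.≤ k
  0≤k = 0≤ι (suc m)

  0≤½y : 0ℚ ℚ.≤ ½ ℚ.* y
  0≤½y = 0≤* 0≤½ (0≤ι (fib (suc m)))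

  l≤rat : ι l ℚ.≤ (x ℚ.+ ½ ℚ.* y) ℚ.* k
  l≤rat = begin
    ι l                              ≤⟨ ι-mono l≤ ⟩
    ι (suc m ℕ.* fib m)              ≡⟨ ι-* (suc m) (fib m) ⟩
    k ℚ.* x                          ≡⟨ ℚ.*-comm k x ⟩
    x ℚ.* k                          ≡⟨ ℚ.+-identityʳ (x ℚ.* k) ⟨
    x ℚ.* k ℚ.+ 0ℚ                   ≤⟨ ℚ.+-monoʳ-≤ (x ℚ.* k) (0≤* 0≤½y 0≤k) ⟩
    x ℚ.* k ℚ.+ ½ ℚ.* y ℚ.* k        ≡⟨ ℚ.*-distribʳ-+ k x (½ ℚ.* y) ⟨
    (x ℚ.+ ½ ℚ.* y) ℚ.* k            ∎
    where open ℚ.≤-Reasoning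

theorem1 : ∃ λ (C : ℚ[√5]) → fromℕ 0 < C ×
    ((n : ℕ) → 1 ℕ.≤ n → (G : Graph n) →
    NumberAtMost (IsMinimalSeparator G) (C * ρ ^ n * fromℕ n))
-- The constant 1 suffices, and `1 ≤ n` leaves only successors.
theorem1 = fromℕ 1 , ℚ.positive⁻¹ 1ℚ , λ where
  (suc m) _ G xs unique minimal → n*fib≤ρ^n*n m (minimal-separators-≤ G xs unique minimal)
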